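{- For all $n \in \mathbb{Z}^+$ and all $h \in \mathbb{N}$ with $0 \leq h < n-1$, there exists a universal cycle for $\mathcal{W}(n,h)$.
   Context: $\mathcal{W}(n)$ denotes the set of weak orders on $[n]$ (transitive and complete relations), represented as words: $\mathcal{W}(n)$ is the set of all words $w_1w_2\ldots w_n$ of length $n$ over the nonnegative integers such that $\{w_1,\dots,w_n\} = \{0,1,\dots,h\}$ for some $h$ with $0 \le h \le n-1$ (here $w_j$ is the height of element $j$ in the weak order). This $h$, i.e. the maximum letter of $w$, is the height of $w$, and $\mathcal{W}(n,h)$ is the set of $w \in \mathcal{W}(n)$ of height $h$; that is, the set of words $w_1\ldots w_n$ with $\{w_1,\dots,w_n\}=\{0,1,\dots,h\}$. Here $\mathbb{N}$ includes $0$. Let $\mathcal{C}$ be a set of $N$ strings, each of length $m$. A universal cycle (ucycle) for $\mathcal{C}$ is a word $a_0a_1\ldots a_{N-1}$ such that each $c \in \mathcal{C}$ appears exactly once as a subword $a_{i+1}a_{i+2}\ldots a_{i+m}$ (one value of $i$ modulo $N$), where subscripts are taken modulo $N$. (In particular every such subword is a string in $\mathcal{C}$.) -}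

module Defs where

open import Data.Fin using (Fin; toℕ)
open import Data.Fin.Properties using (nonZeroIndex)
open import Data.Nat using (ℕ; suc; _+_; _≤_)
open import Data.Nat.DivMod using (_mod_)
open import Data.Product using (Σ; ∃!; _×_)
open import Data.Vec using (Vec; lookup; tabulate)
open import Data.Vec.Membership.Propositional using (_∈_)
open import Data.Vec.Relation.Unary.Unique.Propositional using (Unique)
open import Function.Bundles using (_⇔_)
open import Level using (0ℓ)
open import Relation.Binary.PropositionalEquality using (_≡_)
open import Relation.Unary using (Pred)

-- Weak orders on [n] of height h, as words: w belongs to 𝒲 n h when
-- {w₁,…,wₙ} = {0,1,…,h} as sets.
𝒲 : (n h : ℕ) → Pred (Vec ℕ n) 0ℓ
𝒲 n h w = ∀ k → k ∈ w ⇔ k ≤ h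

-- C has exactly N elements: some repetition-free vector of length N lists
-- precisely the elements of C.
HasSize : {S : Set} → Pred S 0ℓ → ℕ → Set
HasSize {S} C N = Σ (Vec S N) λ v → Unique v × (∀ c → c ∈ v ⇔ C c)

-- a_{i+1} a_{i+2} … a_{i+m}, subscripts taken modulo N.  The index i : Fin N
-- itself witnesses N ≢ 0; m may exceed N, in which case the window wraps
-- around more than once.
window : {A : Set} {N : ℕ} (m : ℕ) → Vec A N → Fin N → Vec A m
window {N = N} m a i =
  tabulate λ j → lookup a (_mod_ (toℕ i + suc (toℕ j)) N {{nonZeroIndex i}})

-- windows∈ already follows from the other two fields by counting; it is
-- recorded to make explicit that every cyclic window is a string of C.
record IsUcycle {A : Set} {m N : ℕ} (C : Pred (Vec A m) 0ℓ) (a : Vec A N) : Set where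
  field
    size     : HasSize C N
    once     : ∀ c → C c → ∃! _≡_ λ i → window m a i ≡ c
    windows∈ : ∀ i → C (window m a i)

{-# OPTIONS --safe #-}
-- Join rotation cycles.  Call a word of 𝒲 n h an edge from its first n-1 letters
-- to its last n-1 letters; a universal cycle is a closed chain through all the
-- edges.  The rotations of one word form a closed chain, and two disjoint closed
-- chains through edges with the same target can be spliced there.  So, up to
-- rotation, a chain can be extended by any word differing in a single letter
-- from one it contains, and it is enough that single-letter changes inside
-- 𝒲 n h connect everything.  They do: when h < n-1, each word can be brought to
-- the form 0 1 … h h … h from left to right, because the part of the word right of
-- the position being set always has a letter that may be overwritten, which makes
-- room for a copy of the letter about to be lost.
module Submission where

open import Data.Fin using (Fin; zero; suc; toℕ; inject₁; fromℕ)
open import Data.Fin.Induction using (<-weakInduction)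
open import Data.Fin.Properties using (toℕ-injective; toℕ-inject₁; toℕ-fromℕ; toℕ-fromℕ<; toℕ<n)
open import Data.Fin.Relation.Unary.Top using (view; ‵fromℕ; ‵inject₁)
open import Data.List as List
  using (List; []; _∷_; length; filter; upTo; applyUpTo; cartesianProductWith)
open import Data.List.Membership.Propositional using () renaming (_∈_ to _∈ₗ_; _∉_ to _∉ₗ_)
import Data.List.Membership.DecPropositional as DecMembership
open import Data.List.Membership.Propositional.Properties
  using (∈-++⁻; ∈-++⁺ˡ; ∈-++⁺ʳ; ∈-∃++; ∈-filter⁺; ∈-filter⁻; ∈-upTo⁺; ∈-upTo⁻; ∈-applyUpTo⁺;
    ∈-applyUpTo⁻; ∈-cartesianProductWith⁺)
open import Data.List.Properties using (filter-notAll; length-upTo; ++-assoc; ++-identityʳ)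
open import Data.List.Relation.Binary.Permutation.Propositional
  using (_↭_; refl; prep; swap; ↭-sym; ↭-trans; ↭⇒↭ₛ)
open import Data.List.Relation.Binary.Permutation.Propositional.Properties
  using (++-comm; ++⁺ˡ; shift; ∈-resp-↭)
import Data.List.Relation.Binary.Permutation.Setoid.Properties as Permutationₛ
open import Data.List.Relation.Binary.Subset.Propositional using (_⊆_)
open import Data.List.Relation.Binary.Disjoint.Propositional using (Disjoint)
import Data.List.Relation.Unary.All as Allₗ
open import Data.List.Relation.Unary.AllPairs using ([]; _∷_)
open import Data.List.Relation.Unary.Any using (here; there)
import Data.List.Relation.Unary.Any as Anyₗ
open import Data.List.Relation.Unary.Unique.Propositional using () renaming (Unique to Uniqueₗ)
import Data.List.Relation.Unary.Unique.Propositional.Properties as Uniqueₗ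
open import Data.Nat using (ℕ; zero; suc; _+_; _∸_; _≤_; _<_; _≥_; z≤n; s≤s; _≟_; _≤?_; NonZero)
open import Data.Nat.DivMod
  using (_%_; _mod_; [m+n]%n≡m%n; m<n⇒m%n≡m; n%n≡0; %-distribˡ-+; m%n%n≡m%n)
open import Data.Nat.GeneralisedArithmetic using (iterate)
open import Data.Nat.Properties
  using (≤-refl; <-≤-trans; ≤-<-trans; m≤n⇒m<n∨m≡n; <⇒≤; m+[n∸m]≡n; +-suc; +-comm;
    +-identityʳ; ≤-pred; m∸n≤m)
open import Data.Product using (Σ; ∃-syntax; ∃!; _×_; _,_; proj₁; proj₂)
open import Data.Sum using (_⊎_; inj₁; inj₂; [_,_]′)
open import Data.Vec
  using (Vec; []; _∷_; _∷ʳ_; _[_]≔_; head; tail; init; lookup; replicate; toList; fromList;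
    map; tabulate)
open import Data.Vec.Membership.Propositional using (_∈_)
open import Data.Vec.Membership.Propositional.Properties
  using (∈-lookup; ∈-toList⁺; ∈-toList⁻; ∈-fromList⁺; ∈-fromList⁻)
open import Data.Vec.Properties
  using (≡-dec; init-∷ʳ; toList-∷ʳ; toList-injective; cast-is-id; length-toList; lookup-map;
    lookup∘updateAt; tabulate∘lookup; tabulate-cong)
import Data.Vec.Relation.Unary.All.Properties as All
open import Data.Vec.Relation.Unary.AllPairs using ([]; _∷_)
open import Data.Vec.Relation.Unary.Any as Any using (here; there)
import Data.Vec.Relation.Unary.Any.Properties as Any
open import Data.Vec.Relation.Unary.Unique.Propositional using (Unique)
open import Data.Vec.Relation.Unary.Unique.Propositional.Properties using (lookup-injective)
open import Function using (_∘_; id; _⇔_; mk⇔; Equivalence)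
open import Level using (0ℓ)
open import Relation.Binary using (DecidableEquality)
open import Relation.Binary.PropositionalEquality
  using (_≡_; _≢_; refl; sym; trans; cong; cong₂; subst; setoid; module ≡-Reasoning)
open import Relation.Nullary using (¬_; yes; no; contradiction)
open import Relation.Nullary.Decidable using (¬?; _×-dec_; map′)
open import Relation.Unary using (Pred; Decidable)
open import Defs

private
  variable
    A : Set
    m n p : ℕ

-- Least witnesses, iteration and repetition-free lists.

least : {P : Pred ℕ 0ℓ} → Decidable P → ∀ n → P n → ∃[ k ] P k × (∀ {j} → j < k → ¬ P j)
least P? n Pn with P? 0
least P? n       Pn | yes P0 = 0 , P0 , λ ()
least P? zero    Pn | no ¬P0 = contradiction Pn ¬P0
least P? (suc n) Pn | no ¬P0 with k , Pk , below ← least (P? ∘ suc) n Pn =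
  suc k , Pk , λ { {zero} _ → ¬P0 ; {suc j} (s≤s j<k) → below j<k }

iterate-suc : ∀ {X : Set} (f : X → X) x k → iterate f x (suc k) ≡ f (iterate f x k)
iterate-suc f x zero    = refl
iterate-suc f x (suc k) = iterate-suc f (f x) k

Unique-resp-↭ : ∀ {X : Set} {xs ys : List X} → xs ↭ ys → Uniqueₗ xs → Uniqueₗ ys
Unique-resp-↭ p = Permutationₛ.Unique-resp-↭ (setoid _) (↭⇒↭ₛ p)

Unique-fromList : ∀ {X : Set} {xs : List X} → Uniqueₗ xs → Unique (fromList xs)
Unique-fromList []         = []
Unique-fromList (x≢ ∷ xs!) = All.fromList⁺ x≢ ∷ Unique-fromList xs!

-- Chains of consecutive edges.

module Chains {E V : Set} (source target : E → V) where

  _⟶_ : E → E → Set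
  x ⟶ y = target x ≡ source y

  -- The list holds only the edges strictly between the two ends. A closed chain `Chain x xs x`
  -- therefore has `x ∷ xs` as its edges, with the common end counted once.
  data Chain : E → List E → E → Set where
    [_] : ∀ {u v} → u ⟶ v → Chain u [] v
    _∷_ : ∀ {u v w xs} → u ⟶ w → Chain w xs v → Chain u (w ∷ xs) v

  _++ᶜ_ : ∀ {u w v xs ys} → Chain u xs w → Chain w ys v → Chain u (xs List.++ w ∷ ys) v
  [ r ]    ++ᶜ d = r ∷ d
  (r ∷ c) ++ᶜ d = r ∷ (c ++ᶜ d)

  splitᶜ : ∀ {u w v} xs {ys} → Chain u (xs List.++ w ∷ ys) v → Chain u xs w × Chain w ys v
  splitᶜ []       (r ∷ c) = [ r ] , c
  splitᶜ (x ∷ xs) (r ∷ c) with c₁ , c₂ ← splitᶜ xs c = r ∷ c₁ , c₂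

  -- A chain sees its starting edge only through the target, so edges with equal targets can
  -- exchange their continuations. Splicing rests on this.
  restart : ∀ {x y xs v} → target x ≡ target y → Chain y xs v → Chain x xs v
  restart eq [ r ]   = [ trans eq r ]
  restart eq (r ∷ c) = trans eq r ∷ c

  rotateᶜ : ∀ {x xs w} → Chain x xs x → w ∈ₗ x ∷ xs → ∃[ ys ] Chain w ys w × (w ∷ ys ↭ x ∷ xs)
  rotateᶜ c (here refl) = _ , c , refl
  rotateᶜ {x} {w = w} c (there w∈xs) with as , bs , refl ← ∈-∃++ w∈xs
    with c₁ , c₂ ← splitᶜ as c = bs List.++ x ∷ as , c₂ ++ᶜ c₁ , ++-comm (w ∷ bs) (x ∷ as)

  chain-lookup : ∀ {x ys z} → Chain x ys z → (i : Fin (length ys)) →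
    lookup (fromList (x ∷ ys)) (inject₁ i) ⟶ lookup (fromList (x ∷ ys)) (suc i)
  chain-lookup (r ∷ c) zero    = r
  chain-lookup (r ∷ c) (suc i) = chain-lookup c i

  chain-last : ∀ {x ys z} → Chain x ys z → lookup (fromList (x ∷ ys)) (fromℕ (length ys)) ⟶ z
  chain-last [ r ]   = r
  chain-last (r ∷ c) = chain-last c

-- Joining orbits of the rotation into larger circuits.

module CycleJoining
  {E V : Set} (_≟ᴱ_ : DecidableEquality E) (source target : E → V)
  (rot : E → E) (link : ∀ x → target x ≡ source (rot x))
  (p : ℕ) (periodic : ∀ x → iterate rot x (suc p) ≡ x)
  (C : Pred E 0ℓ) (C-rot : ∀ {x} → C x → C (rot x))
  where

  open Chains source target public
  open DecMembership _≟ᴱ_ using (_∈?_)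

  -- The field `rotated` makes the edge set a union of whole orbits, so an orbit either lies in the
  -- circuit or is disjoint from it.
  record Circuit : Set where
    field
      {first} : E
      {rest}  : List E
      chain   : Chain first rest first
    edges : List E
    edges = first ∷ rest
    field
      unique  : Uniqueₗ edges
      rotated : ∀ {x} → x ∈ₗ edges → rot x ∈ₗ edges
      sound   : ∀ {x} → x ∈ₗ edges → C x

    iterated : ∀ k {x} → x ∈ₗ edges → iterate rot x k ∈ₗ edges
    iterated zero    x∈ = x∈
    iterated (suc k) x∈ = iterated k (rotated x∈)

    unrotated : ∀ {x} → rot x ∈ₗ edges → x ∈ₗ edges
    -- `p` further rotations take `rot x` back to `x`.
    unrotated {x} rx∈ = subst (_∈ₗ edges) (periodic x) (iterated p rx∈)

    uniterated : ∀ k {x} → iterate rot x k ∈ₗ edges → x ∈ₗ edges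
    uniterated zero    x∈ = x∈
    uniterated (suc k) x∈ = unrotated (uniterated k x∈)

  open Circuit

  rot-injective : ∀ {x y} → rot x ≡ rot y → x ≡ y
  rot-injective {x} {y} eq =
    trans (sym (periodic x)) (trans (cong (λ z → iterate rot z p) eq) (periodic y))

  iterate-cancel : ∀ i d {x} → iterate rot x i ≡ iterate rot x (i + d) → x ≡ iterate rot x d
  iterate-cancel zero    d eq = eq
  iterate-cancel (suc i) d {x} eq = rot-injective (trans (iterate-cancel i d eq) (iterate-suc rot x d))

  orbit-chain : ∀ y k → Chain y (applyUpTo (iterate rot y ∘ suc) k) (iterate rot y (suc k))
  orbit-chain y zero    = [ link y ]
  orbit-chain y (suc k) = link y ∷ orbit-chain (rot y) k

  C-iterate : ∀ k {x} → C x → C (iterate rot x k)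
  C-iterate zero    Cx = Cx
  C-iterate (suc k) Cx = C-iterate k (C-rot Cx)

  record Orbit (y : E) : Set where
    field
      circuit    : Circuit
      first≡     : first circuit ≡ y
      edges⊆     : ∀ {x} → x ∈ₗ edges circuit → ∃[ i ] x ≡ iterate rot y i

  orbit : ∀ {y} → C y → Orbit y
  -- The orbit may be shorter than `suc p`, for instance for a periodic word. The least return time
  -- `suc k` is taken so that no edge is repeated.
  orbit {y} Cy with k , closes , minimal ← least (λ k → iterate rot y (suc k) ≟ᴱ y) p (periodic y) = record
    { circuit = record
      { chain   = subst (Chain y _) closes (orbit-chain y k)
      ; unique  = Uniqueₗ.applyUpTo⁺₁ (iterate rot y) (suc k) distinct
      ; rotated = next ∘ ∈-applyUpTo⁻ (iterate rot y)
      ; sound   = λ x∈ → let i , _ , x≡ = ∈-applyUpTo⁻ (iterate rot y) x∈ in subst C (sym x≡) (C-iterate i Cy)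
      }
    ; first≡ = refl
    ; edges⊆ = λ x∈ → let i , _ , x≡ = ∈-applyUpTo⁻ (iterate rot y) x∈ in i , x≡
    }
    where
    distinct : ∀ {i j} → i < j → j < suc k → iterate rot y i ≢ iterate rot y j
    -- Cancelling `i` rotations from a coincidence would return to `y` too early.
    distinct {i} {suc j} (s≤s i≤j) (s≤s j<k) eq = minimal (≤-<-trans (m∸n≤m j i) j<k)
      (sym (iterate-cancel i (suc (j ∸ i))
        (trans eq (cong (iterate rot y) (sym (trans (+-suc i (j ∸ i)) (cong suc (m+[n∸m]≡n i≤j))))))))

    next : ∀ {x} → ∃[ i ] i < suc k × x ≡ iterate rot y i → rot x ∈ₗ applyUpTo (iterate rot y) (suc k)
    next (i , s≤s i≤k , refl) with m≤n⇒m<n∨m≡n i≤k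
    ... | inj₁ i<k  = subst (_∈ₗ _) (iterate-suc rot y i) (∈-applyUpTo⁺ (iterate rot y) (s≤s i<k))
    ... | inj₂ refl = here (trans (sym (iterate-suc rot y i)) closes)

  record Extension (c : Circuit) (y : E) : Set where
    constructor extension
    field
      extended : Circuit
      extends  : edges c ⊆ edges extended
      reaches  : y ∈ₗ edges extended

  -- The new circuit leaves `x` along `d`, arrives at `first d`, and from there goes on as `c` did
  -- after `x`. Equality of the two targets allows both switches.
  join : ∀ c d → Disjoint (edges d) (edges c) →
         ∀ {x} → x ∈ₗ edges c → target x ≡ target (first d) → Extension c (first d)
  join c d disjoint {x} x∈c same with ys , c′ , x∷ys↭c ← rotateᶜ (chain c) x∈c = extension
    record
      { chain   = restart same (chain d) ++ᶜ restart (sym same) c′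
      ; unique  = Unique-resp-↭ d++c↭new (Uniqueₗ.++⁺ (unique d) (unique c) disjoint)
      ; rotated = [ from-d ∘ rotated d , from-c ∘ rotated c ]′ ∘ cases
      ; sound   = [ sound d , sound c ]′ ∘ cases
      }
    from-c (from-d (here refl))
    where
    new : List E
    new = x ∷ rest d List.++ first d ∷ ys

    d++c↭new : edges d List.++ edges c ↭ new
    d++c↭new = ↭-trans (++⁺ˡ (edges d) (↭-sym x∷ys↭c)) (↭-trans (prep _ (shift x (rest d) ys))
      (↭-trans (swap _ _ refl) (prep _ (↭-sym (shift (first d) (rest d) ys)))))

    from-d : edges d ⊆ new
    from-d = ∈-resp-↭ d++c↭new ∘ ∈-++⁺ˡ

    from-c : edges c ⊆ new
    from-c = ∈-resp-↭ d++c↭new ∘ ∈-++⁺ʳ (edges d)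

    cases : ∀ {z} → z ∈ₗ new → z ∈ₗ edges d ⊎ z ∈ₗ edges c
    cases = ∈-++⁻ (edges d) ∘ ∈-resp-↭ (↭-sym d++c↭new)

  absorb : ∀ c {x y} → x ∈ₗ edges c → C y → target x ≡ target y → Extension c y
  absorb c {y = y} x∈c Cy same with y ∈? edges c
  ... | yes y∈c = extension c id y∈c
  ... | no  y∉c with orbit Cy
  ... | record { circuit = d ; first≡ = refl ; edges⊆ = d⊆ } = join c d disjoint x∈c same
    where
    disjoint : Disjoint (edges d) (edges c)
    -- A common edge is an iterate of `y`; rotating back inside `c` would put `y` itself in `c`.
    disjoint (z∈d , z∈c) with i , refl ← d⊆ z∈d = y∉c (uniterated c i z∈c)

-- Cyclic successor and predecessor of indices.

mod-cong : ∀ {N} a b .{{_ : NonZero N}} → a % N ≡ b % N → a mod N ≡ b mod N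
mod-cong a b eq = toℕ-injective (trans (toℕ-fromℕ< _) (trans eq (sym (toℕ-fromℕ< _))))

toℕ-mod : ∀ (i : Fin (suc p)) → toℕ i mod suc p ≡ i
toℕ-mod i = toℕ-injective (trans (toℕ-fromℕ< _) (m<n⇒m%n≡m (toℕ<n i)))

[toℕ-mod+m]%n : ∀ a b N .{{_ : NonZero N}} → (toℕ (a mod N) + b) % N ≡ (a + b) % N
[toℕ-mod+m]%n a b N = begin
  (toℕ (a mod N) + b) % N     ≡⟨ cong (λ c → (c + b) % N) (toℕ-fromℕ< _) ⟩
  (a % N + b) % N             ≡⟨ %-distribˡ-+ (a % N) b N ⟩
  (a % N % N + b % N) % N     ≡⟨ cong (λ c → (c + b % N) % N) (m%n%n≡m%n a N) ⟩
  (a % N + b % N) % N         ≡⟨ %-distribˡ-+ a b N ⟨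
  (a + b) % N                 ∎
  where open ≡-Reasoning

-- Adding `p` is subtracting one modulo `suc p`, which avoids truncated subtraction.
next prev : Fin (suc p) → Fin (suc p)
next {p} i = suc (toℕ i) mod suc p
prev {p} i = (toℕ i + p) mod suc p

prev-next : ∀ (i : Fin (suc p)) → prev (next i) ≡ i
prev-next {p} i = trans (mod-cong (toℕ (next i) + p) (toℕ i) (begin
  (toℕ (next i) + p) % suc p  ≡⟨ [toℕ-mod+m]%n (suc (toℕ i)) p (suc p) ⟩
  (suc (toℕ i) + p) % suc p   ≡⟨ cong (_% suc p) (+-suc (toℕ i) p) ⟨
  (toℕ i + suc p) % suc p     ≡⟨ [m+n]%n≡m%n (toℕ i) (suc p) ⟩
  toℕ i % suc p               ∎)) (toℕ-mod i)
  where open ≡-Reasoning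

next-mod : ∀ k → next (k mod suc p) ≡ suc k mod suc p
next-mod {p} k = mod-cong (suc (toℕ (k mod suc p))) (suc k) (begin
  suc (toℕ (k mod suc p)) % suc p   ≡⟨ cong (_% suc p) (+-comm 1 _) ⟩
  (toℕ (k mod suc p) + 1) % suc p   ≡⟨ [toℕ-mod+m]%n k 1 (suc p) ⟩
  (k + 1) % suc p                   ≡⟨ cong (_% suc p) (+-comm k 1) ⟩
  suc k % suc p                     ∎)
  where open ≡-Reasoning

next-prev : ∀ (i : Fin (suc p)) → next (prev i) ≡ i
next-prev {p} i = trans (next-mod (toℕ i + p)) (trans (mod-cong (suc (toℕ i + p)) (toℕ i) (begin
  suc (toℕ i + p) % suc p   ≡⟨ cong (_% suc p) (+-suc (toℕ i) p) ⟨
  (toℕ i + suc p) % suc p   ≡⟨ [m+n]%n≡m%n (toℕ i) (suc p) ⟩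
  toℕ i % suc p             ∎)) (toℕ-mod i))
  where open ≡-Reasoning

next-inject₁ : ∀ (i : Fin p) → next (inject₁ i) ≡ suc i
next-inject₁ {p} i = trans (cong (λ k → suc k mod suc p) (toℕ-inject₁ i)) (toℕ-mod (suc i))

next-fromℕ : ∀ p → next (fromℕ p) ≡ zero
next-fromℕ p = toℕ-injective (trans (toℕ-fromℕ< _)
  (trans (cong (λ k → suc k % suc p) (toℕ-fromℕ p)) (n%n≡0 (suc p))))

-- Words, seen as edges from init to tail.

rotate : Vec A (suc m) → Vec A (suc m)
rotate (a ∷ u) = u ∷ʳ a

rotate-link : ∀ (x : Vec A (suc m)) → tail x ≡ init (rotate x)
rotate-link (a ∷ u) = sym (init-∷ʳ a u)

-- Periodicity is proved on lists, where reassociating concatenations does not change the type.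
rotateₗ : List A → List A
rotateₗ []      = []
rotateₗ (a ∷ u) = u List.++ List.[ a ]

-- The suffix `v` collects the letters already moved to the back, as the induction requires;
-- periodicity is the case of empty `v`.
iterate-rotateₗ : ∀ (u v : List A) → iterate rotateₗ (u List.++ v) (length u) ≡ v List.++ u
iterate-rotateₗ []      v = sym (++-identityʳ v)
iterate-rotateₗ (a ∷ u) v = begin
  iterate rotateₗ ((u List.++ v) List.++ List.[ a ]) (length u)
    ≡⟨ cong (λ w → iterate rotateₗ w (length u)) (++-assoc u v _) ⟩
  iterate rotateₗ (u List.++ (v List.++ List.[ a ])) (length u)
    ≡⟨ iterate-rotateₗ u (v List.++ List.[ a ]) ⟩
  (v List.++ List.[ a ]) List.++ u
    ≡⟨ ++-assoc v _ u ⟩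
  v List.++ a ∷ u ∎
  where open ≡-Reasoning

toList-iterate-rotate : ∀ (x : Vec A (suc m)) k → toList (iterate rotate x k) ≡ iterate rotateₗ (toList x) k
toList-iterate-rotate x       zero    = refl
toList-iterate-rotate (a ∷ u) (suc k) = trans (toList-iterate-rotate (u ∷ʳ a) k)
  (cong (λ w → iterate rotateₗ w k) (toList-∷ʳ a u))

rotate-periodic : ∀ (x : Vec A (suc m)) → iterate rotate x (suc m) ≡ x
rotate-periodic {m = m} x = trans (sym (cast-is-id refl _)) (toList-injective refl _ x (begin
  toList (iterate rotate x (suc m))                       ≡⟨ toList-iterate-rotate x (suc m) ⟩
  iterate rotateₗ (toList x) (suc m)                      ≡⟨ cong₂ (iterate rotateₗ) (++-identityʳ _) (length-toList x) ⟨
  iterate rotateₗ (toList x List.++ []) (length (toList x)) ≡⟨ iterate-rotateₗ (toList x) [] ⟩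
  toList x                                                ∎))
  where open ≡-Reasoning

[]≔-∷ʳ : ∀ (u : Vec A m) i b a → (u [ i ]≔ b) ∷ʳ a ≡ (u ∷ʳ a) [ inject₁ i ]≔ b
[]≔-∷ʳ (c ∷ u) zero    b a = refl
[]≔-∷ʳ (c ∷ u) (suc i) b a = cong (c ∷_) ([]≔-∷ʳ u i b a)

rotate-[]≔ : ∀ (x : Vec A (suc m)) i b → rotate (x [ suc i ]≔ b) ≡ rotate x [ inject₁ i ]≔ b
rotate-[]≔ (a ∷ u) i b = []≔-∷ʳ u i b a

∈-∷ʳ : ∀ {k a} (u : Vec A m) → k ∈ u ∷ʳ a ⇔ k ∈ a ∷ u
∈-∷ʳ []      = mk⇔ id id
∈-∷ʳ (c ∷ u) = mk⇔
  (λ { (here eq) → there (here eq) ; (there k∈) → exchange (Equivalence.to (∈-∷ʳ u) k∈) })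
  (λ { (here eq) → there (Equivalence.from (∈-∷ʳ u) (here eq))
     ; (there (here eq)) → here eq
     ; (there (there k∈)) → there (Equivalence.from (∈-∷ʳ u) (there k∈)) })
  where
  exchange : ∀ {k a c} {u : Vec A m} → k ∈ a ∷ u → k ∈ a ∷ c ∷ u
  exchange (here eq)  = here eq
  exchange (there k∈) = there (there k∈)

∈-rotate : ∀ {k} (x : Vec A (suc m)) → k ∈ rotate x ⇔ k ∈ x
∈-rotate (a ∷ u) = ∈-∷ʳ u

∈-[]≔⁻ : ∀ {k b} (u : Vec A m) i → k ∈ u [ i ]≔ b → k ≡ b ⊎ k ∈ u
∈-[]≔⁻ (a ∷ u) zero    (here eq)  = inj₁ eq
∈-[]≔⁻ (a ∷ u) zero    (there k∈) = inj₂ (there k∈)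
∈-[]≔⁻ (a ∷ u) (suc i) (here eq)  = inj₂ (here eq)
∈-[]≔⁻ (a ∷ u) (suc i) (there k∈) with ∈-[]≔⁻ u i k∈
... | inj₁ eq = inj₁ eq
... | inj₂ k∈u = inj₂ (there k∈u)

∈-[]≔⁺ : ∀ {b} (u : Vec A m) i → b ∈ u [ i ]≔ b
∈-[]≔⁺ u i = subst (_∈ (u [ i ]≔ _)) (lookup∘updateAt i u) (∈-lookup i (u [ i ]≔ _))

-- Consecutive windows share all but one letter, so a window is read off the
-- heads of its successors.
lookup-via-heads : (s : ℕ → Vec A (suc m)) → (∀ k → tail (s k) ≡ init (s (suc k))) →
  ∀ j k → lookup (s k) j ≡ head (s (k + toℕ j))
lookup-via-heads s linked = <-weakInduction _
  (λ k → trans (lookup-zero (s k)) (cong (head ∘ s) (sym (+-identityʳ k))))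
  (λ j ih k → begin
    lookup (s k) (suc j)                 ≡⟨ lookup-suc (s k) j ⟩
    lookup (tail (s k)) j                ≡⟨ cong (λ u → lookup u j) (linked k) ⟩
    lookup (init (s (suc k))) j          ≡⟨ lookup-init (s (suc k)) j ⟩
    lookup (s (suc k)) (inject₁ j)       ≡⟨ ih (suc k) ⟩
    head (s (suc k + toℕ (inject₁ j)))   ≡⟨ cong (λ d → head (s (suc k + d))) (toℕ-inject₁ j) ⟩
    head (s (suc k + toℕ j))             ≡⟨ cong (head ∘ s) (+-suc k (toℕ j)) ⟨
    head (s (k + suc (toℕ j)))           ∎)
  where
  open ≡-Reasoning
  lookup-zero : ∀ (x : Vec A (suc m)) → lookup x zero ≡ head x
  lookup-zero (a ∷ u) = refl
  lookup-suc : ∀ (x : Vec A (suc m)) j → lookup x (suc j) ≡ lookup (tail x) j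
  lookup-suc (a ∷ u) j = refl
  lookup-init : ∀ {m} (x : Vec A (suc m)) j → lookup (init x) j ≡ lookup x (inject₁ j)
  lookup-init (a ∷ b ∷ u) zero    = refl
  lookup-init (a ∷ b ∷ u) (suc j) = lookup-init (b ∷ u) j

-- Normal forms by single-letter changes.

module Normalisation {A : Set} (_≟_ : DecidableEquality A) (P : Pred A 0ℓ) where

  open DecMembership _≟_ using (_∈?_)

  -- `P` describes the allowed letters and `D` lists the required ones. They are kept apart because
  -- `D` shrinks as letters are placed on the left, while `P` stays fixed.
  Valid : List A → Vec A n → Set
  Valid D u = (∀ {k} → k ∈ u → P k) × (∀ {k} → k ∈ₗ D → k ∈ u)

  infix 4 _⊢_⇝_

  -- Validity is recorded for each word before its change, not for the last word: paths will be
  -- followed backwards from a word already in a circuit.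
  data _⊢_⇝_ (D : List A) : Vec A n → Vec A n → Set where
    stop : ∀ {u : Vec A n} → D ⊢ u ⇝ u
    step : ∀ {u w : Vec A n} → Valid D u → ∀ i b → D ⊢ u [ i ]≔ b ⇝ w → D ⊢ u ⇝ w

  ∷-valid : ∀ {D F b} {u : Vec A n} → P b → D ⊆ b ∷ F → Valid F u → Valid D (b ∷ u)
  ∷-valid {D = D} {F} {b} {u} Pb D⊆ (ok , cover) =
    (λ { (here refl) → Pb ; (there k∈) → ok k∈ }) , covered ∘ D⊆
    where
    covered : ∀ {k} → k ∈ₗ b ∷ F → k ∈ b ∷ u
    covered (here refl) = here refl
    covered (there k∈)  = there (cover k∈)

  ∷-⇝ : ∀ {D F b} {u w : Vec A n} → P b → D ⊆ b ∷ F → F ⊢ u ⇝ w → D ⊢ b ∷ u ⇝ b ∷ w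
  ∷-⇝ Pb D⊆ stop              = stop
  ∷-⇝ Pb D⊆ (step v i c path) = step (∷-valid Pb D⊆ v) (suc i) c (∷-⇝ Pb D⊆ path)

  without : A → List A → List A
  without c = filter (λ k → ¬? (k ≟ c))

  length-without : ∀ {c D} → c ∈ₗ D → length (without c D) < length D
  length-without {c} {D} c∈D = filter-notAll _ D (Anyₗ.map (λ c≡k k≢c → k≢c (sym c≡k)) c∈D)

  Covers : List A → Vec A n → Set
  Covers D u = ∀ {k} → k ∈ₗ D → k ∈ u

  covers-tail : ∀ {D c} {u : Vec A n} → c ∉ₗ D → Covers D (c ∷ u) → Covers D u
  covers-tail c∉D cover k∈D with cover k∈D
  ... | here refl = contradiction k∈D c∉D
  ... | there k∈u = k∈u

  covers-without : ∀ {D c} {u : Vec A n} → Covers D (c ∷ u) → Covers (without c D) u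
  covers-without {D = D} {c} cover k∈ with k∈D , k≢c ← ∈-filter⁻ (λ k → ¬? (k ≟ c)) {xs = D} k∈
    with cover k∈D
  ... | here k≡c  = contradiction k≡c k≢c
  ... | there k∈u = k∈u

  covers-restore : ∀ {D c} {u : Vec A n} → c ∈ u → Covers (without c D) u → Covers D u
  covers-restore {c = c} c∈u cover {k} k∈D with k ≟ c
  ... | yes refl = c∈u
  ... | no  k≢c  = cover (∈-filter⁺ (λ k → ¬? (k ≟ c)) k∈D k≢c)

  -- Pigeonhole: a first letter outside `D` can be overwritten. Otherwise that letter accounts for
  -- itself, and the search goes on in the tail with a strictly shorter list of requirements.
  redundant : ∀ D (u : Vec A n) → length D < n → Covers D u → ∃[ i ] (∀ b → Covers D (u [ i ]≔ b))
  redundant D (c ∷ u) (s≤s |D|≤n) cover with c ∈? D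
  ... | no c∉D  = zero , λ b → there ∘ covers-tail c∉D cover
  ... | yes c∈D with i , covers ← redundant (without c D) u (<-≤-trans (length-without c∈D) |D|≤n)
                                    (covers-without cover) =
    suc i , λ b → covers-restore (here refl) (there ∘ covers b)

  module _ {z : A} (Pz : P z) where

    normal : List A → ∀ n → Vec A n
    normal []      n       = replicate n z
    normal (b ∷ D) zero    = []
    normal (b ∷ D) (suc n) = b ∷ normal D n

    normal-valid : ∀ D n → (∀ {k} → k ∈ₗ D → P k) → length D ≤ n → Valid D (normal D n)
    normal-valid []      zero    ok _         = (λ ()) , (λ ())
    normal-valid []      (suc n) ok _         = ∷-valid Pz (λ ()) (normal-valid [] n ok z≤n)
    normal-valid (b ∷ D) (suc n) ok (s≤s |D|≤n) =
      ∷-valid (ok (here refl)) id (normal-valid D n (ok ∘ there) |D|≤n)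

    fill : (u : Vec A n) → Valid [] u → [] ⊢ u ⇝ replicate n z
    fill []      v = stop
    fill (a ∷ u) v = step v zero z (∷-⇝ {F = []} Pz (λ ()) (fill u (proj₁ v ∘ there , λ ())))

    -- The strict bound leaves a spare position at every stage: placing `b` uses up one position and
    -- one required letter together.
    normalise : ∀ D (u : Vec A n) → length D < n → Valid D u → D ⊢ u ⇝ normal D n
    normalise []      u       _           v = fill u v
    normalise (b ∷ D) (a ∷ u) (s≤s |D|<n) v@(ok , cover) with a ∈? D
    ... | no a∉D = step v zero b (∷-⇝ (ok (cover (here refl))) id
        (normalise D u |D|<n (ok ∘ there , covers-tail a∉D (cover ∘ there))))
    -- Overwriting `a` could lose a letter that `D` requires, so `a` is first copied to a position
    -- of `u` that is redundant once `a` itself is left out of the requirements.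
    ... | yes a∈D with i , covers ← redundant (without a (b ∷ D)) u
                         (<-≤-trans (length-without (there a∈D)) |D|<n) (covers-without cover) =
      step v (suc i) a (step (ok″ , there ∘ cover′) zero b
        (∷-⇝ (ok (cover (here refl))) id (normalise D (u [ i ]≔ a) |D|<n (ok′ , cover′ ∘ there))))
      where
      cover′ : Covers (b ∷ D) (u [ i ]≔ a)
      cover′ = covers-restore (∈-[]≔⁺ u i) (covers a)

      ok′ : ∀ {k} → k ∈ u [ i ]≔ a → P k
      ok′ k∈ with ∈-[]≔⁻ u i k∈
      ... | inj₁ refl = ok (here refl)
      ... | inj₂ k∈u  = ok (there k∈u)

      ok″ : ∀ {k} → k ∈ a ∷ (u [ i ]≔ a) → P k
      ok″ (here refl) = ok (here refl)
      ok″ (there k∈)  = ok′ k∈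

-- Enumeration of all words over a finite alphabet.

allVecs : List A → ∀ n → List (Vec A n)
allVecs xs zero    = [] ∷ []
allVecs xs (suc n) = cartesianProductWith _∷_ xs (allVecs xs n)

∈-allVecs : ∀ {xs} (u : Vec A n) → (∀ {k} → k ∈ u → k ∈ₗ xs) → u ∈ₗ allVecs xs n
∈-allVecs []      u⊆ = here refl
∈-allVecs (a ∷ u) u⊆ = ∈-cartesianProductWith⁺ _∷_ (u⊆ (here refl)) (∈-allVecs u (u⊆ ∘ there))

-- A circuit through all weak orders of height `h`.

module Ucycle (m h : ℕ) (h<m : h < m) where

  C : Pred (Vec ℕ (suc m)) 0ℓ
  C = 𝒲 (suc m) h

  C-rotate : ∀ {x} → C x → C (rotate x)
  C-rotate {x} Cx k = mk⇔
    (Equivalence.to (Cx k) ∘ Equivalence.to (∈-rotate x))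
    (Equivalence.from (∈-rotate x) ∘ Equivalence.from (Cx k))

  open Normalisation _≟_ (_≤ h)
  open CycleJoining (≡-dec _≟_) init tail rotate rotate-link m rotate-periodic C C-rotate
  open Circuit
  open Extension

  letters : List ℕ
  letters = upTo (suc h)

  C⇒Valid : ∀ {x} → C x → Valid letters x
  C⇒Valid Cx = Equivalence.to (Cx _) , Equivalence.from (Cx _) ∘ ≤-pred ∘ ∈-upTo⁻

  Valid⇒C : ∀ {x} → Valid letters x → C x
  Valid⇒C (ok , cover) k = mk⇔ ok (cover ∘ ∈-upTo⁺ ∘ s≤s)

  -- Validity replaces the quantifier over all naturals by two finite checks: over the letters of
  -- `x` and over `letters`.
  C? : Decidable C
  C? x = map′
    (λ (ok , cover) → Valid⇒C (Allₗ.lookup ok ∘ ∈-toList⁺ , Allₗ.lookup cover))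
    (λ Cx → Allₗ.tabulate (proj₁ (C⇒Valid Cx) ∘ ∈-toList⁻) , Allₗ.tabulate (proj₂ (C⇒Valid Cx)))
    (Allₗ.all? (_≤? h) (toList x) ×-dec Allₗ.all? (λ k → Any.any? (k ≟_) x) letters)

  chain-extensions : ∀ {c y z} (e : Extension c y) → Extension (extended e) z → Extension c z
  chain-extensions e f = extension (extended f) (extends f ∘ extends e) (reaches f)

  -- Rotation moves the changed letter to the front, where the two words share their tail.
  absorb-[]≔ : ∀ i b x c → x [ i ]≔ b ∈ₗ edges c → C x → Extension c x
  absorb-[]≔ = <-weakInduction _
    (λ { b (a ∷ u) c x′∈c Cx → absorb c x′∈c Cx refl })
    (λ i ih b x c x′∈c Cx →
      let e = ih b (rotate x) c (subst (_∈ₗ edges c) (rotate-[]≔ x i b) (rotated c x′∈c)) (C-rotate Cx)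
      in extension (extended e) (extends e) (unrotated (extended e) (reaches e)))

  -- The path is followed backwards: the later words are absorbed first, and each then brings in its
  -- predecessor.
  absorb-⇝ : ∀ {x w} c → letters ⊢ x ⇝ w → w ∈ₗ edges c → Extension c x
  absorb-⇝ c stop              w∈c = extension c id w∈c
  absorb-⇝ c (step v i b path) w∈c = let e = absorb-⇝ c path w∈c in
    chain-extensions e (absorb-[]≔ i b _ (extended e) (reaches e) (Valid⇒C v))

  -- The hypothesis `h < m` enters here: `suc h` letters are required and `suc m` positions are
  -- available.
  |letters|<1+m : length letters < suc m
  |letters|<1+m = subst (_< suc m) (sym (length-upTo (suc h))) (s≤s h<m)

  -- Passing `≤-refl` as the proof of `h ≤ h` fixes the padding letter to be `h`.
  canonical : Vec ℕ (suc m)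
  canonical = normal ≤-refl letters (suc m)

  C-canonical : C canonical
  C-canonical = Valid⇒C
    (normal-valid ≤-refl letters (suc m) (≤-pred ∘ ∈-upTo⁻) (<⇒≤ |letters|<1+m))

  -- Extensions keep `canonical`, so the normalisation path of every further word still ends inside
  -- the current circuit.
  absorb-all : ∀ xs c → canonical ∈ₗ edges c →
    Σ Circuit λ d → edges c ⊆ edges d × (∀ {x} → x ∈ₗ xs → C x → x ∈ₗ edges d)
  absorb-all []       c w∈c = c , id , λ ()
  absorb-all (x ∷ xs) c w∈c with C? x
  ... | no ¬Cx with d , c⊆d , complete ← absorb-all xs c w∈c =
    d , c⊆d , λ { (here refl) Cx → contradiction Cx ¬Cx ; (there x∈) → complete x∈ }
  ... | yes Cx
    with e ← absorb-⇝ c (normalise ≤-refl letters x |letters|<1+m (C⇒Valid Cx)) w∈c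
    with d , e⊆d , complete ← absorb-all xs (extended e) (extends e w∈c) =
    d , e⊆d ∘ extends e , λ { (here refl) _ → e⊆d (reaches e) ; (there x∈) → complete x∈ }

  full : Σ Circuit λ c → ∀ {x} → C x → x ∈ₗ edges c
  full with orbit C-canonical
  ... | record { circuit = o ; first≡ = refl }
    with d , _ , complete ← absorb-all (allVecs letters (suc m)) o (here refl) =
    d , λ {x} Cx → complete (∈-allVecs x (∈-upTo⁺ ∘ s≤s ∘ proj₁ (C⇒Valid Cx))) Cx

  -- Reading the universal cycle off a complete circuit.

  module Spell (c : Circuit) (complete : ∀ {x} → C x → x ∈ₗ edges c) where

    N : ℕ
    N = length (edges c)

    words : Vec (Vec ℕ (suc m)) N
    words = fromList (edges c)

    -- Indexing by all naturals unrolls the circuit into an endless linked sequence, so windows that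
    -- wrap around need no separate treatment.
    word : ℕ → Vec ℕ (suc m)
    word k = lookup words (k mod N)

    word-link : ∀ k → word k ⟶ word (suc k)
    word-link k = subst (λ i → word k ⟶ lookup words i) (next-mod k) (link-next (k mod N))
      where
      link-next : ∀ i → lookup words i ⟶ lookup words (next i)
      link-next i with view i
      -- The last edge is followed by the first because the chain is closed.
      ... | ‵fromℕ     = subst (λ j → lookup words (fromℕ _) ⟶ lookup words j)
                         (sym (next-fromℕ _)) (chain-last (chain c))
      ... | ‵inject₁ i = subst (λ j → lookup words (inject₁ i) ⟶ lookup words j)
                         (sym (next-inject₁ i)) (chain-lookup (chain c) i)

    cycle : Vec ℕ N
    cycle = map head words

    -- The shift by `next` arises because window `i` begins at subscript `i + 1`.
    window-cycle : ∀ i → window (suc m) cycle i ≡ lookup words (next i)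
    window-cycle i = trans (tabulate-cong letter) (tabulate∘lookup _)
      where
      letter : ∀ j → lookup cycle ((toℕ i + suc (toℕ j)) mod N) ≡ lookup (lookup words (next i)) j
      letter j = begin
        lookup cycle ((toℕ i + suc (toℕ j)) mod N)   ≡⟨ lookup-map ((toℕ i + suc (toℕ j)) mod N) head words ⟩
        head (word (toℕ i + suc (toℕ j)))            ≡⟨ cong (head ∘ word) (+-suc (toℕ i) (toℕ j)) ⟩
        head (word (suc (toℕ i) + toℕ j))            ≡⟨ lookup-via-heads word word-link j (suc (toℕ i)) ⟨
        lookup (word (suc (toℕ i))) j                ∎
        where open ≡-Reasoning

    words-unique : Unique words
    words-unique = Unique-fromList (unique c)

    isUcycle : IsUcycle C cycle
    isUcycle = record
      { size     = words , words-unique , λ x → mk⇔ (sound c ∘ ∈-fromList⁻) (∈-fromList⁺ ∘ complete)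
      ; once     = once
      ; windows∈ = λ i → subst C (sym (window-cycle i)) (sound c (∈-fromList⁻ (∈-lookup (next i) words)))
      }
      where
      once : ∀ x → C x → ∃! _≡_ λ i → window (suc m) cycle i ≡ x
      -- `k` is the place of `x` among `words`; `prev` undoes the shift between windows and words.
      once x Cx = prev k , at-k , λ {j} eq → trans (cong prev (same j eq)) (prev-next j)
        where
        x∈words = ∈-fromList⁺ (complete Cx)
        k       = Any.index x∈words

        at-k : window (suc m) cycle (prev k) ≡ x
        at-k = trans (window-cycle (prev k))
          (trans (cong (lookup words) (next-prev k)) (sym (Any.lookup-index x∈words)))

        same : ∀ j → window (suc m) cycle j ≡ x → k ≡ next j
        same j eq = lookup-injective words-unique k (next j)
          (trans (sym (Any.lookup-index x∈words)) (trans (sym eq) (window-cycle j)))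

corollary3p8 : (n h : ℕ) → n ≥ 1 → h < n ∸ 1 →
    ∃[ N ] Σ (Vec ℕ N) (λ a → IsUcycle (𝒲 n h) a)
corollary3p8 (suc m) h _ h<m with c , complete ← Ucycle.full m h h<m =
  _ , _ , Ucycle.Spell.isUcycle m h h<m c complete
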